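{- Let $d\geq 2$ be an integer. For each $G\in\mathbf{G}_d$ let $g_d^{(G)}\in\mathbb{Z}[A_0,\dots,A_{d-1}]$ and $\Delta\in\mathbb{Z}[A_0,\dots,A_{d-1}]$ be the polynomials defined in the context, and let $\mathcal{F}_d=\{\Delta\}\cup\{g_d^{(G)}:G\in\mathbf{G}_d\}=\{g_d^{(1)},\dots,g_d^{(t_d)}\}$ (a finite set). Then for a separable polynomial $f(x)=c_f(x^d+a_{d-1}x^{d-1}+\dots+a_0)$ of degree $d$ over any discretely valued field $K$, the valuations $\textup{ord}(g_d^{(i)}(a_0,\dots,a_{d-1}))$, $i=1,\dots,t_d$, uniquely determine the set of tuples $\{(\textup{ord}(x_i-x_j),i,j):1\leq i<j\leq d\}$ up to reordering of the roots $x_1,\dots,x_d$ of $f(x)$. That is: if $f$ over $K$ (with roots $x_1,\dots,x_d$) and $f'$ over $K'$ (with roots $x'_1,\dots,x'_d$) are two such polynomials with $\textup{ord}_K(g_d^{(i)}(a_0,\dots,a_{d-1}))=\textup{ord}_{K'}(g_d^{(i)}(a'_0,\dots,a'_{d-1}))$ for all $i$, then the roots can be relabelled so that $\textup{ord}_K(x_i-x_j)=\textup{ord}_{K'}(x'_i-x'_j)$ for all $i<j$.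
   Context: For a discretely valued field $K$, $\textup{ord}$ denotes the valuation normalised with respect to a uniformiser of $K$, extended to an algebraic closure $\bar K$, with $\textup{ord}(0)=\infty$. Weighted graphs: a weighted graph on vertices $V=\{v_1,\dots,v_d\}$ is $G=(V,E,w)$ with $E$ a set of (unordered, simple) edges and $w:E\to\mathbb{Z}_{\geq0}$; pairs not in $E$ are regarded as having weight $0$. $S_d$ acts on labelled weighted graphs by permuting vertices: $\sigma(G)=(V,\sigma(E),\sigma(w))$ with $\sigma(E)=\{v_{\sigma(i)}v_{\sigma(j)}:v_iv_j\in E\}$ and $\sigma(w)(v_{\sigma(i)}v_{\sigma(j)})=w(v_iv_j)$. For $\sigma\in S_d/\mathrm{Stab}_{S_d}(G)$ put $S_G^\sigma=1/\prod_{v_iv_j\in\sigma(E)}(X_i-X_j)^{2\sigma(w)(v_iv_j)}$ and $J_G=\sum_{\sigma\in S_d/\mathrm{Stab}_{S_d}(G)}S_G^\sigma\in\mathbb{Q}(X_1,\dots,X_d)$ (i.e. the sum over the distinct labelled graphs in the $S_d$-orbit of $G$); $J_G$ is symmetric and depends only on the isomorphism class of $G$. $\mathbf{G}_d$ is the set of weighted graphs $G=(V,E,w)$ on $d$ vertices such that (a) $w$ maps $E$ surjectively onto $\{1,\dots,m\}$ for some integer $m\geq1$, and (b) for all vertices $v_1,v_2,v_3$, $w(v_1v_2)\geq\min(w(v_2v_3),w(v_1v_3))$ (non-edges having weight $0$); equivalently, for each $1\le k\le m$, deleting all edges of weight $\leq k$ leaves a disjoint union of complete graphs. For $G\in\mathbf{G}_d$,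 write $J_G=f_d^{(G)}(X_1,\dots,X_d)/\prod_{i<j}(X_i-X_j)^{2k_G}$ in lowest terms, with $f_d^{(G)}\in\mathbb{Z}[X_1,\dots,X_d]$ symmetric and $k_G\ge 0$ an integer. Put $A_i=(-1)^{d-i}\sum_{1\leq k_1<\dots<k_{d-i}\leq d}X_{k_1}\cdots X_{k_{d-i}}$ for $i=0,\dots,d-1$ (so if $x^d+a_{d-1}x^{d-1}+\dots+a_0=\prod(x-x_i)$ then $a_i=A_i(x_1,\dots,x_d)$). Then $g_d^{(G)}\in\mathbb{Z}[A_0,\dots,A_{d-1}]$ is defined by $f_d^{(G)}(X_1,\dots,X_d)=g_d^{(G)}(A_0,\dots,A_{d-1})$, and $\Delta\in\mathbb{Z}[A_0,\dots,A_{d-1}]$ by $\prod_{i<j}(X_i-X_j)^2=\Delta(A_0,\dots,A_{d-1})$. -}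

module Defs where

open import Level using (Level; _⊔_; 0ℓ) renaming (suc to lsuc)
open import Algebra.Bundles using (CommutativeRing)
open import Algebra.Morphism.Structures using (module RingMorphisms)
open import Data.Nat as ℕ using (ℕ; zero; suc)
open import Data.Integer using (ℤ)
open import Data.Rational as ℚ using (ℚ; 1ℚ)
open import Data.Fin as Fin using (Fin)
open import Data.Fin.Permutation using (Permutation′; _⟨$⟩ʳ_; _⟨$⟩ˡ_)
open import Data.Vec as Vec using (Vec; []; _∷_)
open import Data.List as List using (List; []; _∷_)
open import Data.List.Relation.Unary.Any using (Any)
open import Data.List.Relation.Unary.All using (All)
open import Data.List.Relation.Unary.AllPairs using (AllPairs)
open import Data.List.Membership.Propositional using (_∈_)
open import Data.Product using (Σ; ∃; ∃-syntax; _×_; _,_; proj₁; proj₂)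
open import Relation.Nullary using (¬_; yes; no)
open import Relation.Binary.PropositionalEquality using (_≡_; _≢_)

module _ {c ℓ} (R : CommutativeRing c ℓ) where
  open CommutativeRing R

  sub : Carrier → Carrier → Carrier
  sub x y = x + (- y)

  horner : List Carrier → Carrier → Carrier
  horner []       y = 0#
  horner (a ∷ as) y = a + y * horner as y

  record IsField : Set (c ⊔ ℓ) where
    field
      nontrivial : ¬ (1# ≈ 0#)
      inverse    : ∀ x → ¬ (x ≈ 0#) → ∃[ y ] (x * y ≈ 1#)

  IsAlgClosed : Set (c ⊔ ℓ)
  IsAlgClosed = ∀ (n : ℕ) (cs : Vec Carrier (suc n)) (lead : Carrier) →
    ¬ (lead ≈ 0#) → ∃[ y ] (horner (Vec.toList cs List.++ (lead ∷ [])) y ≈ 0#)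

data ℚ∞ : Set where
  fin : ℚ → ℚ∞
  ∞   : ℚ∞

_+∞_ : ℚ∞ → ℚ∞ → ℚ∞
fin p +∞ fin q = fin (p ℚ.+ q)
fin p +∞ ∞     = ∞
∞     +∞ _     = ∞

data _≤∞_ : ℚ∞ → ℚ∞ → Set where
  fin≤fin : ∀ {p q} → p ℚ.≤ q → fin p ≤∞ fin q
  _≤∞∞    : ∀ x → x ≤∞ ∞

min∞ : ℚ∞ → ℚ∞ → ℚ∞
min∞ (fin p) (fin q) = fin (p ℚ.⊓ q)
min∞ (fin p) ∞       = fin p
min∞ ∞       y       = y

-- Discretely valued field K, with algebraic closure K̄ and the normalised
-- valuation ord of K extended to K̄.

record DVF (c ℓ : Level) : Set (lsuc (c ⊔ ℓ)) where
  field
    K       : CommutativeRing c ℓ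
    K-field : IsField K
    K̄       : CommutativeRing c ℓ
    K̄-field : IsField K̄
    K̄-closed : IsAlgClosed K̄
    ι       : CommutativeRing.Carrier K → CommutativeRing.Carrier K̄
    ι-hom   : RingMorphisms.IsRingHomomorphism
                (CommutativeRing.rawRing K) (CommutativeRing.rawRing K̄) ι
    K̄-algebraic : ∀ (y : CommutativeRing.Carrier K̄) →
      ∃[ p ] (Any (λ a → ¬ (CommutativeRing._≈_ K a (CommutativeRing.0# K))) p
              × CommutativeRing._≈_ K̄ (horner K̄ (List.map ι p) y) (CommutativeRing.0# K̄))
    ord     : CommutativeRing.Carrier K̄ → ℚ∞
    ord-cong : ∀ {x y} → CommutativeRing._≈_ K̄ x y → ord x ≡ ord y
    ord-∞   : ∀ x → (ord x ≡ ∞ → CommutativeRing._≈_ K̄ x (CommutativeRing.0# K̄))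
                  × (CommutativeRing._≈_ K̄ x (CommutativeRing.0# K̄) → ord x ≡ ∞)
    ord-*   : ∀ x y → ord (CommutativeRing._*_ K̄ x y) ≡ ord x +∞ ord y
    ord-+   : ∀ x y → min∞ (ord x) (ord y) ≤∞ ord (CommutativeRing._+_ K̄ x y)
    ord-K-ℤ : ∀ (a : CommutativeRing.Carrier K) →
      ¬ (CommutativeRing._≈_ K a (CommutativeRing.0# K)) →
      ∃[ z ] (ord (ι a) ≡ fin (z ℚ./ 1))
    uniformiser : ∃[ π ] (ord (ι π) ≡ fin 1ℚ)

-- Polynomials over ℤ in n variables (as ring expressions)

infixl 6 _⊕_
infixl 7 _⊗_

data Poly (n : ℕ) : Set where
  var : Fin n → Poly n
  zer : Poly n
  one : Poly n
  _⊕_ : Poly n → Poly n → Poly n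
  _⊗_ : Poly n → Poly n → Poly n
  ⊝_  : Poly n → Poly n

_⊖_ : ∀ {n} → Poly n → Poly n → Poly n
p ⊖ q = p ⊕ (⊝ q)

_^P_ : ∀ {n} → Poly n → ℕ → Poly n
p ^P zero  = one
p ^P suc k = p ⊗ (p ^P k)

⟦_⟧ : ∀ {n c ℓ} → Poly n → (R : CommutativeRing c ℓ) →
      (Fin n → CommutativeRing.Carrier R) → CommutativeRing.Carrier R
⟦ var i ⟧ R ρ = ρ i
⟦ zer ⟧   R ρ = CommutativeRing.0# R
⟦ one ⟧   R ρ = CommutativeRing.1# R
⟦ p ⊕ q ⟧ R ρ = CommutativeRing._+_ R (⟦ p ⟧ R ρ) (⟦ q ⟧ R ρ)
⟦ p ⊗ q ⟧ R ρ = CommutativeRing._*_ R (⟦ p ⟧ R ρ) (⟦ q ⟧ R ρ)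
⟦ ⊝ p ⟧   R ρ = CommutativeRing.-_ R (⟦ p ⟧ R ρ)

-- equality in ℤ[X_1..X_n]: identity in every commutative ring
_≐_ : ∀ {n} → Poly n → Poly n → Set₁
_≐_ {n} p q = ∀ (R : CommutativeRing 0ℓ 0ℓ) (ρ : Fin n → CommutativeRing.Carrier R) →
  CommutativeRing._≈_ R (⟦ p ⟧ R ρ) (⟦ q ⟧ R ρ)

_∘P_ : ∀ {m n} → Poly m → (Fin m → Poly n) → Poly n
var i   ∘P σ = σ i
zer     ∘P σ = zer
one     ∘P σ = one
(p ⊕ q) ∘P σ = (p ∘P σ) ⊕ (q ∘P σ)
(p ⊗ q) ∘P σ = (p ∘P σ) ⊗ (q ∘P σ)
(⊝ p)   ∘P σ = ⊝ (p ∘P σ)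

-- coefficients (ascending) of ∏_{i<n} (T - r_i), as a vector of length n+1
mulLin : ∀ {n k} → Vec (Poly n) (suc k) → Poly n → Vec (Poly n) (suc (suc k))
mulLin cs r = Vec.zipWith _⊖_ (zer ∷ cs) (Vec.map (r ⊗_) cs Vec.∷ʳ zer)

linProd : ∀ {m} (n : ℕ) → (Fin n → Poly m) → Vec (Poly m) (suc n)
linProd zero    r = one ∷ []
linProd (suc n) r = mulLin (linProd n (λ i → r (Fin.suc i))) (r Fin.zero)

-- A_i ∈ ℤ[X_1..X_d]: x^d + A_{d-1} x^{d-1} + ... + A_0 = ∏ (x - X_i)
A : (d : ℕ) → Fin d → Poly d
A d i = Vec.lookup (linProd d var) (Fin.inject₁ i)

pairs : (d : ℕ) → List (Fin d × Fin d)
pairs d = List.concatMap (λ i → List.map (i ,_)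
            (List.filter (λ j → i Fin.<? j) (List.allFin d))) (List.allFin d)

prodP : ∀ {n} → List (Poly n) → Poly n
prodP = List.foldr _⊗_ one

Disc : (d : ℕ) → Poly d
Disc d = prodP (List.map (λ ij → (var (proj₁ ij) ⊖ var (proj₂ ij)) ^P 2) (pairs d))

-- Weighted graphs on vertices Fin d, encoded by a weight function
-- (weight 0 = non-edge, diagonal 0)

Wt : ℕ → Set
Wt d = Fin d → Fin d → ℕ

InGd : ∀ {d} → Wt d → Set
InGd {d} W =
    (∀ i → W i i ≡ 0)
  × (∀ i j → W i j ≡ W j i)
  × (∃[ m ] (1 ℕ.≤ m
             × (∀ i j → W i j ℕ.≤ m)
             × (∀ k → 1 ℕ.≤ k → k ℕ.≤ m → ∃[ i ] ∃[ j ] (W i j ≡ k))))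
  × (∀ i j k → i ≢ j → j ≢ k → i ≢ k → ℕ._⊓_ (W j k) (W i k) ℕ.≤ W i j)

-- σ(G): σ(w)(v_{σ i} v_{σ j}) = w(v_i v_j)
relabel : ∀ {d} → Permutation′ d → Wt d → Wt d
relabel σ W i j = W (σ ⟨$⟩ˡ i) (σ ⟨$⟩ˡ j)

SameWt : ∀ {d} → Wt d → Wt d → Set
SameWt U V = ∀ i j → U i j ≡ V i j

IsOrbit : ∀ {d} → Wt d → List (Wt d) → Set
IsOrbit {d} W L =
    All (λ U → ∃[ σ ] SameWt U (relabel σ W)) L
  × (∀ (σ : Permutation′ d) → Any (λ U → SameWt U (relabel σ W)) L)
  × AllPairs (λ U V → ¬ SameWt U V) L

-- S_G^σ = 1 / ∏_{edges} (X_i - X_j)^{2 w}; we keep the denominator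
denom : ∀ {d} → Wt d → Poly d
denom {d} U = prodP (List.map (λ ij → (var (proj₁ ij) ⊖ var (proj₂ ij)) ^P (2 ℕ.* U (proj₁ ij) (proj₂ ij))) (pairs d))

Frac : ℕ → Set
Frac n = Poly n × Poly n

fadd : ∀ {n} → Frac n → Frac n → Frac n
fadd (a , b) (c , e) = (a ⊗ e ⊕ c ⊗ b , b ⊗ e)

_≐F_ : ∀ {n} → Frac n → Frac n → Set₁
(a , b) ≐F (c , e) = (a ⊗ e) ≐ (c ⊗ b)

-- J_G = Σ_{σ ∈ S_d / Stab} S_G^σ, summed over an orbit list
J : ∀ {d} → List (Wt d) → Frac d
J L = List.foldr fadd (zer , one) (List.map (λ U → (one , denom U)) L)

-- Data for g_d^{(G)}: J_G = f/Δ^{k_G} in lowest terms, f = g(A_0,...,A_{d-1})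
record GData {d : ℕ} (W : Wt d) : Set₁ where
  field
    orbit    : List (Wt d)
    isOrbit  : IsOrbit W orbit
    k        : ℕ
    g        : Poly d
    g-spec   : J orbit ≐F ((g ∘P A d) , (Disc d ^P k))
    lowest   : ∀ k′ → k′ ℕ.< k → ¬ (∃[ f ] (J orbit ≐F (f , (Disc d ^P k′))))

IsDelta : ∀ {d} → Poly d → Set₁
IsDelta {d} Δ = (Δ ∘P A d) ≐ Disc d

-- Separable degree-d polynomial f = c (x^d + a_{d-1} x^{d-1} + ... + a_0)
-- over K, with roots x_1..x_d in K̄.

record SepPoly {c ℓ} (F : DVF c ℓ) (d : ℕ) : Set (c ⊔ ℓ) where
  open DVF F
  field
    cf      : CommutativeRing.Carrier K
    cf≠0    : ¬ (CommutativeRing._≈_ K cf (CommutativeRing.0# K))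
    a       : Fin d → CommutativeRing.Carrier K
    x       : Fin d → CommutativeRing.Carrier K̄
    -- x^d + Σ a_i x^i = ∏ (x - x_i), coefficientwise
    roots   : ∀ i → CommutativeRing._≈_ K̄ (ι (a i)) (⟦ A d i ⟧ K̄ x)
    distinct : ∀ i j → i ≢ j → ¬ (CommutativeRing._≈_ K̄ (x i) (x j))

ordAt : ∀ {c ℓ} {F : DVF c ℓ} {d} → SepPoly F d → Poly d → ℚ∞
ordAt {F = F} f h = DVF.ord F (DVF.ι F (⟦ h ⟧ (DVF.K F) (SepPoly.a f)))

ordRoots : ∀ {c ℓ} {F : DVF c ℓ} {d} → SepPoly F d → Fin d → Fin d → ℚ∞
ordRoots {F = F} f i j = DVF.ord F (sub (DVF.K̄ F) (SepPoly.x f i) (SepPoly.x f j))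

{-# OPTIONS --safe #-}
module Submission where

-- Write v for the ultrametric v i j = ord (xᵢ - xⱼ), and for a list L of thresholds let W be the weighted
-- graph W i j = #{t ∈ L : t ≤ v i j}.  Rearranging, the labelling W itself is the unique one in its orbit
-- maximising the pairing ∑ W i j · v i j over ordered pairs i ≠ j, so exactly one summand of J_W has minimal
-- valuation and ord g_W reveals this maximum.  For the second polynomial, with ultrametric v′, the same
-- valuation forces some relabelling σ W to satisfy ∑ W · v ≤ ∑ σ W · v′.
--
-- Subtracting the thresholds turns this into an inequality between sums of (v - t)⁺.  Taking L = [t], with the
-- roles of v and v′ exchanged, gives ∑ (v′ - t)⁺ ≤ ∑ (v - t)⁺ for every t; taking for L all values of v then
-- forces equality term by term, so that v ∘ σ ≤ v′ pointwise.  Both sides have the same sum ord Δ, hence agree.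

open import Defs
open import Level using (Level; 0ℓ)
open import Algebra.Bundles using (CommutativeRing)
open import Algebra.Morphism.Structures using (module RingMorphisms)
import Algebra.Properties.CommutativeMonoid.Sum as Sum
import Algebra.Properties.Monoid.Mult as Mult
import Algebra.Properties.Ring as RingProperties
open import Data.Bool using (if_then_else_; true; false)
open import Data.Nat as ℕ using (ℕ; zero; suc; _≤_)
import Data.Nat.Properties as ℕ
open import Data.Rational as ℚ using (ℚ; 0ℚ; 1ℚ; _+_; _-_; -_)
import Data.Rational.Properties as ℚ
open import Data.Rational.Solver using (module +-*-Solver)
open import Data.Fin as Fin using (Fin; _≟_; _<_)
import Data.Fin.Properties as Fin
open import Data.Fin.Permutation as Permutation using (Permutation′; _⟨$⟩ʳ_; _⟨$⟩ˡ_; flip; inverseʳ)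
open import Data.List as List using (List; []; _∷_; _++_)
open import Data.List.Membership.Propositional using (_∈_)
open import Data.List.Membership.Propositional.Properties
  using (∈-map⁺; ∈-map⁻; ∈-filter⁺; ∈-filter⁻; ∈-cartesianProduct⁺; ∈-allFin)
open import Data.List.Relation.Unary.All as All using (All; []; _∷_)
import Data.List.Relation.Unary.All.Properties as All
open import Data.List.Relation.Unary.AllPairs using (AllPairs; []; _∷_)
open import Data.List.Relation.Unary.Any as Any using (Any; here; there)
open import Data.Product using (Σ; _×_; _,_; proj₁; proj₂; ∃-syntax)
open import Data.Sum using (_⊎_; inj₁; inj₂)
open import Function using (_∘_)
open import Relation.Binary using (tri<; tri≈; tri>)
open import Relation.Binary.PropositionalEquality hiding (J; [_])
import Relation.Binary.Reasoning.Setoid as SetoidReasoning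
open import Relation.Nullary using (¬_; Dec; yes; no; does; contradiction)
open import Relation.Nullary.Decidable using (dec-true; dec-false; ¬?; _×-dec_)
open import Relation.Unary using (Decidable)

open +-*-Solver using (solve; _:+_; _:-_; _:=_)
open Sum ℚ.+-0-commutativeMonoid using (sum; sum-cong-≗; ∑-distrib-+; ∑-comm; sum-permute)
open Mult ℚ.+-0-monoid using (×-homo-+) renaming (_×_ to infixr 8 _·_)

-- Inequalities between rationals and multiples of 1

≤⇒≯ : ∀ {p q} → p ℚ.≤ q → ¬ (q ℚ.< p)
≤⇒≯ p≤q q<p = ℚ.<-irrefl refl (ℚ.<-≤-trans q<p p≤q)

+-cancelʳ-≤ : ∀ r {p q} → p + r ℚ.≤ q + r → p ℚ.≤ q
+-cancelʳ-≤ r {p} {q} le = ℚ.≮⇒≥ λ q<p → ≤⇒≯ le (ℚ.+-monoˡ-< r q<p)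

0≤·1 : ∀ n → 0ℚ ℚ.≤ n · 1ℚ
0≤·1 zero    = ℚ.≤-refl
0≤·1 (suc n) = ℚ.+-mono-≤ (ℚ.nonNegative⁻¹ 1ℚ) (0≤·1 n)

·1-mono-≤ : ∀ {m n} → m ℕ.≤ n → m · 1ℚ ℚ.≤ n · 1ℚ
·1-mono-≤ {n = n} ℕ.z≤n = 0≤·1 n
·1-mono-≤ (ℕ.s≤s m≤n)   = ℚ.+-monoʳ-≤ 1ℚ (·1-mono-≤ m≤n)

-- Sums of weights are compared in ℚ, where `∑≠` lives; this brings the outcome back to ℕ.
·1-cancel-≤ : ∀ m n → m · 1ℚ ℚ.≤ n · 1ℚ → m ℕ.≤ n
·1-cancel-≤ zero    n       _  = ℕ.z≤n
·1-cancel-≤ (suc m) zero    le = contradiction (ℚ.+-mono-<-≤ (ℚ.positive⁻¹ 1ℚ) (0≤·1 m)) (≤⇒≯ le)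
·1-cancel-≤ (suc m) (suc n) le = ℕ.s≤s (·1-cancel-≤ m n
  (+-cancelʳ-≤ 1ℚ (subst₂ ℚ._≤_ (ℚ.+-comm 1ℚ (m · 1ℚ)) (ℚ.+-comm 1ℚ (n · 1ℚ)) le)))

-- Sums over ordered pairs of distinct indices

sum-mono : ∀ {n} {f g : Fin n → ℚ} → (∀ i → f i ℚ.≤ g i) → sum f ℚ.≤ sum g
sum-mono {zero} f≤g = ℚ.≤-refl
sum-mono {suc n} f≤g = ℚ.+-mono-≤ (f≤g Fin.zero) (sum-mono (f≤g ∘ Fin.suc))

-- If `f i < g i` held at one index, the bounds at the remaining indices would give `sum f < sum g`.
sum-tight : ∀ {n} {f g : Fin n → ℚ} → (∀ i → f i ℚ.≤ g i) → sum g ℚ.≤ sum f → ∀ i → g i ℚ.≤ f i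
sum-tight f≤g le Fin.zero =
  ℚ.≮⇒≥ λ f<g → ≤⇒≯ le (ℚ.+-mono-<-≤ f<g (sum-mono (f≤g ∘ Fin.suc)))
sum-tight f≤g le (Fin.suc i) = sum-tight (f≤g ∘ Fin.suc)
  (ℚ.≮⇒≥ λ f<g → ≤⇒≯ le (ℚ.+-mono-≤-< (f≤g Fin.zero) f<g)) i

-- Diagonal entries stand for the valuation of 0 and carry no meaningful rational, so they are
-- masked; bounds are then needed for `i ≢ j` only.
offDiag : ∀ {d} → (Fin d → Fin d → ℚ) → Fin d → Fin d → ℚ
offDiag f i j = if does (i ≟ j) then 0ℚ else f i j

∑≠ : ∀ {d} → (Fin d → Fin d → ℚ) → ℚ
∑≠ f = sum λ i → sum λ j → offDiag f i j

module _ {d : ℕ} where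

  private variable f g : Fin d → Fin d → ℚ

  offDiag-mono : (∀ i j → i ≢ j → f i j ℚ.≤ g i j) → ∀ i j → offDiag f i j ℚ.≤ offDiag g i j
  offDiag-mono f≤g i j with i ≟ j
  ... | yes _  = ℚ.≤-refl
  ... | no i≢j = f≤g i j i≢j

  ∑≠-mono : (∀ i j → i ≢ j → f i j ℚ.≤ g i j) → ∑≠ f ℚ.≤ ∑≠ g
  ∑≠-mono f≤g = sum-mono λ i → sum-mono (offDiag-mono f≤g i)

  ∑≠-cong : (∀ i j → i ≢ j → f i j ≡ g i j) → ∑≠ f ≡ ∑≠ g
  ∑≠-cong {f} {g} f≡g = ℚ.≤-antisym (∑≠-mono {f} {g} λ i j i≢j → ℚ.≤-reflexive (f≡g i j i≢j))
                            (∑≠-mono {g} {f} λ i j i≢j → ℚ.≤-reflexive (sym (f≡g i j i≢j)))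

  ∑≠-tight : (∀ i j → i ≢ j → f i j ℚ.≤ g i j) → ∑≠ g ℚ.≤ ∑≠ f → ∀ i j → i ≢ j → g i j ℚ.≤ f i j
  ∑≠-tight {f} {g} f≤g le i j i≢j = go (sum-tight (offDiag-mono f≤g i)
      (sum-tight (λ i → sum-mono (offDiag-mono f≤g i)) le i) j)
    where
    go : offDiag g i j ℚ.≤ offDiag f i j → g i j ℚ.≤ f i j
    go with i ≟ j
    ... | yes i≡j = contradiction i≡j i≢j
    ... | no _    = λ p → p

  ∑≠-distrib-+ : ∀ (f g : Fin d → Fin d → ℚ) → ∑≠ (λ i j → f i j + g i j) ≡ ∑≠ f + ∑≠ g
  ∑≠-distrib-+ f g = trans
    (sum-cong-≗ λ i → trans (sum-cong-≗ (pointwise i)) (∑-distrib-+ (offDiag f i) (offDiag g i)))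
    (∑-distrib-+ (λ i → sum (offDiag f i)) (λ i → sum (offDiag g i)))
    where
    pointwise : ∀ i j → offDiag (λ i j → f i j + g i j) i j ≡ offDiag f i j + offDiag g i j
    pointwise i j with i ≟ j
    ... | yes _ = refl
    ... | no _  = refl

  ⟨$⟩ˡ-≢ : (σ : Permutation′ d) → ∀ {i j} → i ≢ j → σ ⟨$⟩ˡ i ≢ σ ⟨$⟩ˡ j
  ⟨$⟩ˡ-≢ σ i≢j eq = i≢j (trans (sym (inverseʳ σ)) (trans (cong (σ ⟨$⟩ʳ_) eq) (inverseʳ σ)))

  infixl 9 _∘₂_
  -- The inverse is used so that `relabel σ U` is `U ∘₂ σ` by definition.
  _∘₂_ : {A : Set} → (Fin d → Fin d → A) → Permutation′ d → Fin d → Fin d → A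
  (f ∘₂ σ) i j = f (σ ⟨$⟩ˡ i) (σ ⟨$⟩ˡ j)

  ∑≠-permute : ∀ (f : Fin d → Fin d → ℚ) (σ : Permutation′ d) → ∑≠ f ≡ ∑≠ (f ∘₂ σ)
  ∑≠-permute f σ = trans (sum-permute (λ i → sum (offDiag f i)) (flip σ))
    (sum-cong-≗ λ i → trans (sum-permute (offDiag f (σ ⟨$⟩ˡ i)) (flip σ)) (sum-cong-≗ (pointwise i)))
    where
    pointwise : ∀ i j → offDiag f (σ ⟨$⟩ˡ i) (σ ⟨$⟩ˡ j) ≡ offDiag (f ∘₂ σ) i j
    pointwise i j with i ≟ j | σ ⟨$⟩ˡ i ≟ σ ⟨$⟩ˡ j
    ... | yes _    | yes _ = refl
    ... | no _     | no _  = refl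
    ... | yes refl | no ne = contradiction refl ne
    ... | no i≢j   | yes e = contradiction e (⟨$⟩ˡ-≢ σ i≢j)

-- Thresholds and rearrangement

-- Opaque because ℚ._≤?_ unfolds to a comparison of numerators, which with-abstraction then misses.
opaque
  _≤?_ : ∀ p q → Dec (p ℚ.≤ q)
  _≤?_ = ℚ._≤?_

count : List ℚ → ℚ → ℕ
count []      q = 0
count (t ∷ L) q = if does (t ≤? q) then suc (count L q) else count L q

total : List ℚ → ℚ → ℚ
total []      q = 0ℚ
total (t ∷ L) q = (if does (t ≤? q) then t else 0ℚ) + total L q

step : ℚ → ℚ → ℚ → ℚ
step t q y = if does (t ≤? q) then y - t else 0ℚ

-- Here `q` selects the thresholds and `y` is measured against them. For `q = y` this is the sum of
-- the positive parts `(y - t)⁺`.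
excess : List ℚ → ℚ → ℚ → ℚ
excess []      q y = 0ℚ
excess (t ∷ L) q y = step t q y + excess L q y

-- The hypothesis tests the thresholds in `L` only, instead of asking for `q ≤ r`, because that is
-- all `excess-tight` can supply.
count-mono : ∀ L {q r} → (∀ {t} → t ∈ L → t ℚ.≤ q → t ℚ.≤ r) → count L q ℕ.≤ count L r
count-mono [] h = ℕ.z≤n
count-mono (t ∷ L) {q} {r} h with t ≤? q | t ≤? r
... | yes _ | yes _ = ℕ.s≤s (count-mono L (h ∘ there))
... | yes p | no ¬p = contradiction (h (here refl) p) ¬p
... | no _  | yes _ = ℕ.m≤n⇒m≤1+n (count-mono L (h ∘ there))
... | no _  | no _  = count-mono L (h ∘ there)

-- Write `y` as `(y - t) + t` once for each threshold `t ≤ q`. The second part depends on `q` alone,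
-- so its sum over all pairs is unchanged by relabelling.
count-excess : ∀ L q y → count L q · y ≡ excess L q y + total L q
count-excess [] q y = refl
count-excess (t ∷ L) q y with t ≤? q
... | yes _ = trans (cong (y +_) (count-excess L q y))
  (solve 4 (λ y t e c → y :+ (e :+ c) := (y :- t :+ e) :+ (t :+ c)) refl y t (excess L q y) (total L q))
... | no _  = trans (count-excess L q y)
  (cong₂ _+_ (sym (ℚ.+-identityˡ (excess L q y))) (sym (ℚ.+-identityˡ (total L q))))

0≤-⁻ : ∀ {t y} → t ℚ.≤ y → 0ℚ ℚ.≤ y - t
0≤-⁻ {t} {y} t≤y = subst (ℚ._≤ y - t) (ℚ.+-inverseʳ t) (ℚ.+-monoˡ-≤ (- t) t≤y)

-⁻<0 : ∀ {t y} → y ℚ.< t → y - t ℚ.< 0ℚ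
-⁻<0 {t} {y} y<t = subst (y - t ℚ.<_) (ℚ.+-inverseʳ t) (ℚ.+-monoˡ-< (- t) y<t)

-- Selecting by `y` itself keeps `y - t` exactly when it is nonnegative.
step-max : ∀ t q y → step t q y ℚ.≤ step t y y
step-max t q y with t ≤? q | t ≤? y
... | yes _ | yes _  = ℚ.≤-refl
... | yes _ | no t≰y = ℚ.<⇒≤ (-⁻<0 (ℚ.≰⇒> t≰y))
... | no _  | yes le = 0≤-⁻ le
... | no _  | no _   = ℚ.≤-refl

step-tight : ∀ t q y → step t y y ℚ.≤ step t q y → t ℚ.≤ q → t ℚ.≤ y
step-tight t q y le t≤q with t ≤? q | t ≤? y
... | yes _   | yes t≤y = t≤y
... | yes _   | no t≰y  = contradiction le (λ le → ≤⇒≯ le (-⁻<0 (ℚ.≰⇒> t≰y)))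
... | no t≰q  | _       = contradiction t≤q t≰q

excess-max : ∀ L q y → excess L q y ℚ.≤ excess L y y
excess-max []      q y = ℚ.≤-refl
excess-max (t ∷ L) q y = ℚ.+-mono-≤ (step-max t q y) (excess-max L q y)

-- Since `step-max` holds term by term, equality of the sums makes every term tight; a threshold
-- with `y < t ≤ q` would contribute the negative `y - t` in place of 0.
excess-tight : ∀ L q y → excess L y y ℚ.≤ excess L q y → ∀ {t} → t ∈ L → t ℚ.≤ q → t ℚ.≤ y
excess-tight (t ∷ L) q y le (here refl) = step-tight t q y
  (ℚ.≮⇒≥ λ lt → ≤⇒≯ le (ℚ.+-mono-<-≤ lt (excess-max L q y)))
excess-tight (t ∷ L) q y le (there t∈L) = excess-tight L q y
  (ℚ.≮⇒≥ λ lt → ≤⇒≯ le (ℚ.+-mono-≤-< (step-max t q y) lt)) t∈L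

module _ {d : ℕ} where

  pairing : Wt d → (Fin d → Fin d → ℚ) → ℚ
  pairing U v = ∑≠ λ i j → U i j · v i j

  levels : List ℚ → (Fin d → Fin d → ℚ) → Wt d
  levels L v i j = if does (i ≟ j) then 0 else count L (v i j)

  levels-off : ∀ L v {i j} → i ≢ j → levels L v i j ≡ count L (v i j)
  levels-off L v {i} {j} i≢j with i ≟ j
  ... | yes i≡j = contradiction i≡j i≢j
  ... | no _    = refl

  levels-diag : ∀ L v i → levels L v i i ≡ 0
  levels-diag L v i with i ≟ i
  ... | yes _ = refl
  ... | no ne = contradiction refl ne

  -- Serves both with `v′ = v`, for the uniqueness of the maximising labelling, and with `v′` from
  -- another polynomial, for the alignment of roots.
  module Rearrangement (L : List ℚ) (v v′ : Fin d → Fin d → ℚ) (σ : Permutation′ d)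
    (le : pairing (levels L v) v ℚ.≤ pairing (relabel σ (levels L v)) v′) where

    pairing-excess : ∀ (u y : Fin d → Fin d → ℚ) {U : Wt d} → (∀ {i j} → i ≢ j → U i j ≡ count L (u i j)) →
      pairing U y ≡ ∑≠ (λ i j → excess L (u i j) (y i j)) + ∑≠ (λ i j → total L (u i j))
    pairing-excess u y U≡ = trans
      (∑≠-cong λ i j i≢j → trans (cong (_· y i j) (U≡ i≢j)) (count-excess L (u i j) (y i j)))
      (∑≠-distrib-+ (λ i j → excess L (u i j) (y i j)) (λ i j → total L (u i j)))

    -- The `total` parts of the two pairings differ by a relabelling only, so they cancel.
    excess-≤ : ∑≠ (λ i j → excess L (v i j) (v i j)) ℚ.≤ ∑≠ (λ i j → excess L ((v ∘₂ σ) i j) (v′ i j))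
    excess-≤ = +-cancelʳ-≤ (∑≠ λ i j → total L (v i j)) (begin
      ∑≠ (λ i j → excess L (v i j) (v i j)) + ∑≠ (λ i j → total L (v i j))
        ≡⟨ pairing-excess v v (levels-off L v) ⟨
      pairing (levels L v) v
        ≤⟨ le ⟩
      pairing (relabel σ (levels L v)) v′
        ≡⟨ pairing-excess (v ∘₂ σ) v′ (λ i≢j → levels-off L v (⟨$⟩ˡ-≢ σ i≢j)) ⟩
      ∑≠ (λ i j → excess L ((v ∘₂ σ) i j) (v′ i j)) + ∑≠ (λ i j → total L ((v ∘₂ σ) i j))
        ≡⟨ cong (∑≠ (λ i j → excess L ((v ∘₂ σ) i j) (v′ i j)) +_)
             (∑≠-permute (λ i j → total L (v i j)) σ) ⟨
      ∑≠ (λ i j → excess L ((v ∘₂ σ) i j) (v′ i j)) + ∑≠ (λ i j → total L (v i j)) ∎)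
      where open ℚ.≤-Reasoning

    excess-bound : ∑≠ (λ i j → excess L (v i j) (v i j)) ℚ.≤ ∑≠ (λ i j → excess L (v′ i j) (v′ i j))
    excess-bound = ℚ.≤-trans excess-≤ (∑≠-mono λ i j _ → excess-max L ((v ∘₂ σ) i j) (v′ i j))

    -- The bound closes `excess-≤` and `excess-max` into a circle, so `excess-max` is an equality at
    -- every pair `i ≢ j`, and `excess-tight` applies there.
    aligned : ∑≠ (λ i j → excess L (v′ i j) (v′ i j)) ℚ.≤ ∑≠ (λ i j → excess L (v i j) (v i j)) →
      ∀ {i j} → i ≢ j → ∀ {t} → t ∈ L → t ℚ.≤ (v ∘₂ σ) i j → t ℚ.≤ v′ i j
    aligned bound {i} {j} i≢j = excess-tight L _ _
      (∑≠-tight (λ i j _ → excess-max L ((v ∘₂ σ) i j) (v′ i j)) (ℚ.≤-trans bound excess-≤) i j i≢j)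

  -- The relabelled weights lie below the original ones and have the same sum; the latter is compared in ℚ.
  self-pairing-max : ∀ L v (σ : Permutation′ d) →
    pairing (levels L v) v ℚ.≤ pairing (relabel σ (levels L v)) v →
    SameWt (levels L v) (relabel σ (levels L v))
  self-pairing-max L v σ le i j with i ≟ j
  ... | yes refl = sym (levels-diag L v (σ ⟨$⟩ˡ i))
  ... | no i≢j = ℕ.≤-antisym
          (·1-cancel-≤ _ _ (subst (λ n → n · 1ℚ ℚ.≤ relabel σ W i j · 1ℚ) (levels-off L v i≢j)
            (∑≠-tight {f = λ i j → relabel σ W i j · 1ℚ} {λ i j → W i j · 1ℚ} (λ i j i≢j → ·1-mono-≤ (below i≢j))
              (ℚ.≤-reflexive (∑≠-permute (λ i j → W i j · 1ℚ) σ)) i j i≢j)))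
          (subst (relabel σ W i j ℕ.≤_) (levels-off L v i≢j) (below i≢j))
    where
    W = levels L v
    below : ∀ {i j} → i ≢ j → relabel σ W i j ℕ.≤ W i j
    below i≢j = subst₂ ℕ._≤_ (sym (levels-off L v (⟨$⟩ˡ-≢ σ i≢j))) (sym (levels-off L v i≢j))
      (count-mono L (Rearrangement.aligned L v v σ le ℚ.≤-refl i≢j))

-- Polynomial identities in rings at all levels

-- ℤ[X₁,…,Xₙ] as a free commutative ring: _≐_ only speaks of rings at level 0,
-- and an identity in this one specialises to rings at every level.
infix 4 _∼_
data _∼_ {n : ℕ} : Poly n → Poly n → Set where
  ∼-refl  : ∀ {p} → p ∼ p
  ∼-sym   : ∀ {p q} → p ∼ q → q ∼ p
  ∼-trans : ∀ {p q r} → p ∼ q → q ∼ r → p ∼ r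
  ⊕-cong  : ∀ {p p′ q q′} → p ∼ p′ → q ∼ q′ → p ⊕ q ∼ p′ ⊕ q′
  ⊗-cong  : ∀ {p p′ q q′} → p ∼ p′ → q ∼ q′ → p ⊗ q ∼ p′ ⊗ q′
  ⊝-cong  : ∀ {p p′} → p ∼ p′ → ⊝ p ∼ ⊝ p′
  ⊕-assoc : ∀ p q r → (p ⊕ q) ⊕ r ∼ p ⊕ (q ⊕ r)
  ⊕-comm  : ∀ p q → p ⊕ q ∼ q ⊕ p
  ⊕-idˡ   : ∀ p → zer ⊕ p ∼ p
  ⊕-invˡ  : ∀ p → (⊝ p) ⊕ p ∼ zer
  ⊗-assoc : ∀ p q r → (p ⊗ q) ⊗ r ∼ p ⊗ (q ⊗ r)
  ⊗-comm  : ∀ p q → p ⊗ q ∼ q ⊗ p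
  ⊗-idˡ   : ∀ p → one ⊗ p ∼ p
  ⊗-distˡ : ∀ p q r → p ⊗ (q ⊕ r) ∼ (p ⊗ q) ⊕ (p ⊗ r)

freeRing : ℕ → CommutativeRing 0ℓ 0ℓ
freeRing n = record
  { Carrier = Poly n ; _≈_ = _∼_ ; _+_ = _⊕_ ; _*_ = _⊗_ ; -_ = ⊝_ ; 0# = zer ; 1# = one
  ; isCommutativeRing = record
    { isRing = record
      { +-isAbelianGroup = record
        { isGroup = record
          { isMonoid = record
            { isSemigroup = record
              { isMagma = record
                { isEquivalence = record { refl = ∼-refl ; sym = ∼-sym ; trans = ∼-trans }
                ; ∙-cong = ⊕-cong }
              ; assoc = ⊕-assoc }
            ; identity = ⊕-idˡ , λ p → ∼-trans (⊕-comm p zer) (⊕-idˡ p) }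
          ; inverse = ⊕-invˡ , λ p → ∼-trans (⊕-comm p (⊝ p)) (⊕-invˡ p)
          ; ⁻¹-cong = ⊝-cong }
        ; comm = ⊕-comm }
      ; *-cong = ⊗-cong
      ; *-assoc = ⊗-assoc
      ; *-identity = ⊗-idˡ , λ p → ∼-trans (⊗-comm p one) (⊗-idˡ p)
      ; distrib = ⊗-distˡ , λ p q r → ∼-trans (⊗-comm (q ⊕ r) p)
          (∼-trans (⊗-distˡ p q r) (⊕-cong (⊗-comm p q) (⊗-comm p r))) }
    ; *-comm = ⊗-comm } }

eval-free : ∀ {n} (p : Poly n) → ⟦ p ⟧ (freeRing n) var ≡ p
eval-free (var i) = refl
eval-free zer     = refl
eval-free one     = refl
eval-free (p ⊕ q) = cong₂ _⊕_ (eval-free p) (eval-free q)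
eval-free (p ⊗ q) = cong₂ _⊗_ (eval-free p) (eval-free q)
eval-free (⊝ p)   = cong ⊝_ (eval-free p)

module Evaluation {c ℓ} (R : CommutativeRing c ℓ) where
  private module R = CommutativeRing R

  eval-∼ : ∀ {n} {p q : Poly n} ρ → p ∼ q → ⟦ p ⟧ R ρ R.≈ ⟦ q ⟧ R ρ
  eval-∼ ρ ∼-refl          = R.refl
  eval-∼ ρ (∼-sym e)       = R.sym (eval-∼ ρ e)
  eval-∼ ρ (∼-trans e e′)  = R.trans (eval-∼ ρ e) (eval-∼ ρ e′)
  eval-∼ ρ (⊕-cong e e′)   = R.+-cong (eval-∼ ρ e) (eval-∼ ρ e′)
  eval-∼ ρ (⊗-cong e e′)   = R.*-cong (eval-∼ ρ e) (eval-∼ ρ e′)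
  eval-∼ ρ (⊝-cong e)      = R.-‿cong (eval-∼ ρ e)
  eval-∼ ρ (⊕-assoc p q r) = R.+-assoc _ _ _
  eval-∼ ρ (⊕-comm p q)    = R.+-comm _ _
  eval-∼ ρ (⊕-idˡ p)       = R.+-identityˡ _
  eval-∼ ρ (⊕-invˡ p)      = R.-‿inverseˡ _
  eval-∼ ρ (⊗-assoc p q r) = R.*-assoc _ _ _
  eval-∼ ρ (⊗-comm p q)    = R.*-comm _ _
  eval-∼ ρ (⊗-idˡ p)       = R.*-identityˡ _
  eval-∼ ρ (⊗-distˡ p q r) = R.distribˡ _ _ _

  -- In `freeRing n` the variables evaluate each polynomial to itself, so the instance of `p≐q`
  -- there is a derivation of `p ∼ q`, which is sound in `R`.
  eval-≐ : ∀ {n} {p q : Poly n} → p ≐ q → ∀ ρ → ⟦ p ⟧ R ρ R.≈ ⟦ q ⟧ R ρ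
  eval-≐ {n} {p} {q} p≐q ρ =
    eval-∼ ρ (subst₂ _∼_ (eval-free p) (eval-free q) (p≐q (freeRing n) var))

  eval-∘P : ∀ {m n} (p : Poly m) (σ : Fin m → Poly n) ρ → ⟦ p ∘P σ ⟧ R ρ ≡ ⟦ p ⟧ R (λ i → ⟦ σ i ⟧ R ρ)
  eval-∘P (var i) σ ρ = refl
  eval-∘P zer     σ ρ = refl
  eval-∘P one     σ ρ = refl
  eval-∘P (p ⊕ q) σ ρ = cong₂ R._+_ (eval-∘P p σ ρ) (eval-∘P q σ ρ)
  eval-∘P (p ⊗ q) σ ρ = cong₂ R._*_ (eval-∘P p σ ρ) (eval-∘P q σ ρ)
  eval-∘P (⊝ p)   σ ρ = cong R.-_ (eval-∘P p σ ρ)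

  eval-cong : ∀ {n} (p : Poly n) {ρ ρ′} → (∀ i → ρ i R.≈ ρ′ i) → ⟦ p ⟧ R ρ R.≈ ⟦ p ⟧ R ρ′
  eval-cong (var i) e = e i
  eval-cong zer     e = R.refl
  eval-cong one     e = R.refl
  eval-cong (p ⊕ q) e = R.+-cong (eval-cong p e) (eval-cong q e)
  eval-cong (p ⊗ q) e = R.*-cong (eval-cong p e) (eval-cong q e)
  eval-cong (⊝ p)   e = R.-‿cong (eval-cong p e)

module _ {c ℓ} {R S : CommutativeRing c ℓ} {ι : CommutativeRing.Carrier R → CommutativeRing.Carrier S}
  (ι-hom : RingMorphisms.IsRingHomomorphism (CommutativeRing.rawRing R) (CommutativeRing.rawRing S) ι) where
  private
    module S = CommutativeRing S
    module ι = RingMorphisms.IsRingHomomorphism ι-hom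

  eval-hom : ∀ {n} (p : Poly n) ρ → ι (⟦ p ⟧ R ρ) S.≈ ⟦ p ⟧ S (ι ∘ ρ)
  eval-hom (var i) ρ = S.refl
  eval-hom zer     ρ = ι.0#-homo
  eval-hom one     ρ = ι.1#-homo
  eval-hom (p ⊕ q) ρ = S.trans (ι.+-homo _ _) (S.+-cong (eval-hom p ρ) (eval-hom q ρ))
  eval-hom (p ⊗ q) ρ = S.trans (ι.*-homo _ _) (S.*-cong (eval-hom p ρ) (eval-hom q ρ))
  eval-hom (⊝ p)   ρ = S.trans (ι.-‿homo _) (S.-‿cong (eval-hom p ρ))

-- Sums over lists and over pairs i < j

listSum : {A : Set} → (A → ℚ) → List A → ℚ
listSum f = List.foldr (λ a → f a +_) 0ℚ

module _ {A : Set} where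

  listSum-++ : ∀ (f : A → ℚ) xs ys → listSum f (xs ++ ys) ≡ listSum f xs + listSum f ys
  listSum-++ f []       ys = sym (ℚ.+-identityˡ _)
  listSum-++ f (x ∷ xs) ys = trans (cong (f x +_) (listSum-++ f xs ys)) (sym (ℚ.+-assoc (f x) _ _))

  listSum-map : ∀ {B : Set} (f : A → ℚ) (g : B → A) xs → listSum f (List.map g xs) ≡ listSum (f ∘ g) xs
  listSum-map f g []       = refl
  listSum-map f g (x ∷ xs) = cong (f (g x) +_) (listSum-map f g xs)

  listSum-concatMap : ∀ {B : Set} (f : A → ℚ) (g : B → List A) xs →
    listSum f (List.concatMap g xs) ≡ listSum (listSum f ∘ g) xs
  listSum-concatMap f g []       = refl
  listSum-concatMap f g (x ∷ xs) =
    trans (listSum-++ f (g x) _) (cong (listSum f (g x) +_) (listSum-concatMap f g xs))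

  listSum-filter : ∀ {P : A → Set} (P? : Decidable P) (f : A → ℚ) xs →
    listSum f (List.filter P? xs) ≡ listSum (λ a → if does (P? a) then f a else 0ℚ) xs
  listSum-filter P? f [] = refl
  listSum-filter P? f (x ∷ xs) with does (P? x)
  ... | true  = cong (f x +_) (listSum-filter P? f xs)
  ... | false = trans (listSum-filter P? f xs) (sym (ℚ.+-identityˡ _))

  listSum-tabulate : ∀ {n} (f : A → ℚ) (g : Fin n → A) → listSum f (List.tabulate g) ≡ sum (f ∘ g)
  listSum-tabulate {zero}  f g = refl
  listSum-tabulate {suc n} f g = cong (f (g Fin.zero) +_) (listSum-tabulate f (g ∘ Fin.suc))

above : ∀ {d} → (Fin d → Fin d → ℚ) → Fin d → Fin d → ℚ
above f i j = if does (i Fin.<? j) then f i j else 0ℚ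

listSum-pairs : ∀ {d} (f : Fin d → Fin d → ℚ) →
  listSum (λ ij → f (proj₁ ij) (proj₂ ij)) (pairs d) ≡ sum λ i → sum (above f i)
listSum-pairs {d} f = trans (listSum-concatMap f′ row (List.allFin d))
  (trans (listSum-tabulate (listSum f′ ∘ row) (λ i → i)) (sum-cong-≗ λ i →
    trans (listSum-map f′ (i ,_) (List.filter (i Fin.<?_) (List.allFin d)))
    (trans (listSum-filter (i Fin.<?_) (f i) (List.allFin d)) (listSum-tabulate (above f i) (λ j → j)))))
  where
  f′ : Fin d × Fin d → ℚ
  f′ (i , j) = f i j
  row : Fin d → List (Fin d × Fin d)
  row i = List.map (i ,_) (List.filter (i Fin.<?_) (List.allFin d))

pairs-< : ∀ d → All (λ ij → proj₁ ij Fin.< proj₂ ij) (pairs d)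
pairs-< d = All.concat⁺ (All.map⁺ (All.universal (λ i → All.map⁺ (All.all-filter (i Fin.<?_) (List.allFin d))) (List.allFin d)))

module _ {d : ℕ} (f : Fin d → Fin d → ℚ) where

  above-< : ∀ i j → i Fin.< j → above f i j ≡ f i j
  above-< i j i<j = cong (λ b → if b then f i j else 0ℚ) (dec-true (i Fin.<? j) i<j)

  above-≮ : ∀ i j → ¬ (i Fin.< j) → above f i j ≡ 0ℚ
  above-≮ i j i≮j = cong (λ b → if b then f i j else 0ℚ) (dec-false (i Fin.<? j) i≮j)

  offDiag-above : (∀ i j → f i j ≡ f j i) → ∀ i j → offDiag f i j ≡ above f i j + above f j i
  offDiag-above f-sym i j with i ≟ j
  ... | yes refl = sym (cong₂ _+_ (above-≮ i i (Fin.<-irrefl refl)) (above-≮ i i (Fin.<-irrefl refl)))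
  ... | no i≢j with Fin.<-cmp i j
  ...   | tri< i<j _ j≮i = sym (trans (cong₂ _+_ (above-< i j i<j) (above-≮ j i j≮i)) (ℚ.+-identityʳ _))
  ...   | tri≈ _ i≡j _   = contradiction i≡j i≢j
  ...   | tri> i≮j _ j<i = sym (trans (cong₂ _+_ (above-≮ i j i≮j) (above-< j i j<i))
                             (trans (ℚ.+-identityˡ _) (f-sym j i)))

  -- By symmetry and an exchange of summation, the second copy of the sum over `i < j` becomes the
  -- sum over `j < i`.
  listSum-pairs-double : (∀ i j → f i j ≡ f j i) →
    listSum (λ ij → f (proj₁ ij) (proj₂ ij) + f (proj₁ ij) (proj₂ ij)) (pairs d) ≡ ∑≠ f
  listSum-pairs-double f-sym = begin
    listSum (λ ij → f (proj₁ ij) (proj₂ ij) + f (proj₁ ij) (proj₂ ij)) (pairs d)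
      ≡⟨ double (pairs d) ⟩
    listSum (λ ij → f (proj₁ ij) (proj₂ ij)) (pairs d) + listSum (λ ij → f (proj₁ ij) (proj₂ ij)) (pairs d)
      ≡⟨ cong₂ _+_ (listSum-pairs f) (trans (listSum-pairs f) (∑-comm (above f))) ⟩
    sum (λ i → sum (λ j → above f i j)) + sum (λ i → sum (λ j → above f j i))
      ≡⟨ ∑-distrib-+ (λ i → sum (above f i)) (λ i → sum (λ j → above f j i)) ⟨
    sum (λ i → sum (λ j → above f i j) + sum (λ j → above f j i))
      ≡⟨ sum-cong-≗ (λ i → trans (sym (∑-distrib-+ (above f i) (λ j → above f j i)))
           (sum-cong-≗ λ j → sym (offDiag-above f-sym i j))) ⟩
    ∑≠ f ∎
    where
    open ≡-Reasoning
    double : ∀ ps → listSum (λ ij → f (proj₁ ij) (proj₂ ij) + f (proj₁ ij) (proj₂ ij)) ps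
           ≡ listSum (λ ij → f (proj₁ ij) (proj₂ ij)) ps + listSum (λ ij → f (proj₁ ij) (proj₂ ij)) ps
    double [] = refl
    double ((i , j) ∷ ps) = trans (cong (f i j + f i j +_) (double ps))
      (solve 2 (λ a b → (a :+ a) :+ (b :+ b) := (a :+ b) :+ (a :+ b)) refl (f i j) _)

-- Valuations

infix 4 _<∞_
-- The lower bound is always finite, while the right side may be ∞, as for a numerator of `J` that
-- vanishes at the roots.
data _<∞_ : ℚ → ℚ∞ → Set where
  fin<fin : ∀ {p q} → p ℚ.< q → p <∞ fin q
  fin<∞   : ∀ {p} → p <∞ ∞

<∞-irrefl : ∀ {p} → ¬ (p <∞ fin p)
<∞-irrefl (fin<fin p<p) = ℚ.<-irrefl refl p<p

<∞-≤∞-trans : ∀ {p x y} → p <∞ x → x ≤∞ y → p <∞ y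
<∞-≤∞-trans (fin<fin p<q) (fin≤fin q≤r) = fin<fin (ℚ.<-≤-trans p<q q≤r)
<∞-≤∞-trans (fin<fin _)   (_ ≤∞∞)       = fin<∞
<∞-≤∞-trans fin<∞         (_ ≤∞∞)       = fin<∞

<∞-min∞ : ∀ {p x y} → p <∞ x → p <∞ y → p <∞ min∞ x y
<∞-min∞ {p} (fin<fin {q = q} p<q) (fin<fin {q = r} p<r) with ℚ.≤-total q r
... | inj₁ q≤r = fin<fin (subst (p ℚ.<_) (sym (ℚ.p≤q⇒p⊓q≡p q≤r)) p<q)
... | inj₂ r≤q = fin<fin (subst (p ℚ.<_) (sym (ℚ.p≥q⇒p⊓q≡q r≤q)) p<r)
<∞-min∞ (fin<fin p<q) fin<∞ = fin<fin p<q
<∞-min∞ fin<∞         p<y   = p<y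

<∞-+∞ : ∀ {p x} q → p <∞ x → p + q <∞ x +∞ fin q
<∞-+∞ q (fin<fin p<r) = fin<fin (ℚ.+-monoˡ-< q p<r)
<∞-+∞ q fin<∞         = fin<∞

min∞-<∞ : ∀ {p x} → p <∞ x → min∞ (fin p) x ≡ fin p
min∞-<∞ (fin<fin p<q) = cong fin (ℚ.p≤q⇒p⊓q≡p (ℚ.<⇒≤ p<q))
min∞-<∞ fin<∞         = refl

fin-injective : ∀ {p q} → fin p ≡ fin q → p ≡ q
fin-injective refl = refl

+∞-fin-injective : ∀ x {q r} → x +∞ fin q ≡ fin r → x ≡ fin (r - q)
+∞-fin-injective (fin p) {q} refl = cong fin (solve 2 (λ p q → p := p :+ q :- q) refl p q)

double-zero : ∀ q → q + q ≡ 0ℚ → q ≡ 0ℚ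
double-zero q eq with ℚ.<-cmp q 0ℚ
... | tri< q<0 _ _ = contradiction (ℚ.+-mono-< q<0 q<0) (ℚ.<-irrefl eq)
... | tri≈ _ e _   = e
... | tri> _ _ 0<q = contradiction (ℚ.+-mono-< 0<q 0<q) (ℚ.<-irrefl (sym eq))

-‿+-comm : ∀ p s b → (p - b) + s ≡ (s + p) - b
-‿+-comm = solve 3 (λ p s b → (p :- b) :+ s := (s :+ p) :- b) refl

s+δ-B<δ : ∀ {s B δ} → s ℚ.< B → s + δ - B ℚ.< δ
s+δ-B<δ {s} {B} {δ} s<B = subst₂ ℚ._<_ (solve 3 (λ s δ b → s :+ (δ :- b) := s :+ δ :- b) refl s δ B)
  (solve 2 (λ δ b → b :+ (δ :- b) := δ) refl δ B) (ℚ.+-monoˡ-< (δ - B) s<B)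

module Valuation {c ℓ} (F : DVF c ℓ) where
  open DVF F
  open CommutativeRing K̄ using (Carrier; 0#; 1#; _≈_)
    renaming (_+_ to _+ᴷ_; _*_ to _*ᴷ_; -_ to -ᴷ_)
  private module K̄ = CommutativeRing K̄
  open RingProperties K̄.ring using (-1*x≈-x; -‿involutive)

  ord-1 : ord 1# ≡ fin 0ℚ
  ord-1 with ord 1# in eq | trans (sym (ord-* 1# 1#)) (ord-cong (K̄.*-identityˡ 1#))
  ... | fin q | e = cong fin (trans (solve 1 (λ q → q := (q :+ q) :- q) refl q)
                      (trans (cong (_- q) (fin-injective e)) (ℚ.+-inverseʳ q)))
  ... | ∞     | _ = contradiction (proj₁ (ord-∞ 1#) eq) (IsField.nontrivial K̄-field)

  -- The square of -1 is 1, so twice the valuation is 0; the value ∞ is excluded because its double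
  -- would be ∞.
  ord-‿1 : ord (-ᴷ 1#) ≡ fin 0ℚ
  ord-‿1 with ord (-ᴷ 1#) | trans (sym (ord-* (-ᴷ 1#) (-ᴷ 1#)))
      (trans (ord-cong (K̄.trans (-1*x≈-x (-ᴷ 1#)) (-‿involutive 1#))) ord-1)
  ... | fin q | e = cong fin (double-zero q (fin-injective e))

  ord-‿ : ∀ x → ord (-ᴷ x) ≡ ord x
  ord-‿ x = trans (ord-cong (K̄.sym (-1*x≈-x x)))
    (trans (ord-* (-ᴷ 1#) x) (trans (cong (_+∞ ord x) ord-‿1) (zero-+∞ (ord x))))
    where
    zero-+∞ : ∀ x → fin 0ℚ +∞ x ≡ x
    zero-+∞ (fin q) = cong fin (ℚ.+-identityˡ q)
    zero-+∞ ∞       = refl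

  ord-*-fin : ∀ {p q} a b → ord a ≡ fin p → ord b ≡ fin q → ord (a *ᴷ b) ≡ fin (p + q)
  ord-*-fin a b ord-a ord-b = trans (ord-* a b) (cong₂ _+∞_ ord-a ord-b)

  ord-*-> : ∀ {p q} a b → p <∞ ord a → ord b ≡ fin q → p + q <∞ ord (a *ᴷ b)
  ord-*-> {q = q} a b p<a ord-b =
    subst (_ <∞_) (sym (trans (ord-* a b) (cong (ord a +∞_) ord-b))) (<∞-+∞ q p<a)

  ord-1* : ∀ {x} a → ord a ≡ x → ord (1# *ᴷ a) ≡ x
  ord-1* a = trans (ord-cong (K̄.*-identityˡ a))

  ord-+-> : ∀ {q a b} → q <∞ ord a → q <∞ ord b → q <∞ ord (a +ᴷ b)
  ord-+-> q<a q<b = <∞-≤∞-trans (<∞-min∞ q<a q<b) (ord-+ _ _)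

  -- If the valuation of the sum exceeded `p`, so would that of `a`, which is the sum minus `b`.
  ord-+-dominant : ∀ {p a b} → ord a ≡ fin p → p <∞ ord b → ord (a +ᴷ b) ≡ fin p
  ord-+-dominant {p} {a} {b} ord-a p<b =
    equality (subst (_≤∞ ord (a +ᴷ b)) (trans (cong (λ x → min∞ x (ord b)) ord-a) (min∞-<∞ p<b)) (ord-+ a b))
      (λ p<sum → <∞-irrefl (subst (p <∞_) (trans (ord-cong cancel) ord-a)
        (ord-+-> p<sum (subst (p <∞_) (sym (ord-‿ b)) p<b))))
    where
    cancel : (a +ᴷ b) +ᴷ (-ᴷ b) ≈ a
    cancel = K̄.trans (K̄.+-assoc _ _ _) (K̄.trans (K̄.+-congˡ (K̄.-‿inverseʳ b)) (K̄.+-identityʳ a))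
    equality : ∀ {x} → fin p ≤∞ x → ¬ (p <∞ x) → x ≡ fin p
    equality (fin≤fin p≤q) p≮q = cong fin (ℚ.≤-antisym (ℚ.≮⇒≥ (p≮q ∘ fin<fin)) p≤q)
    equality (_ ≤∞∞)       p≮q = contradiction fin<∞ p≮q

  module _ {n} (ρ : Fin n → Carrier) where

    ord-^P : ∀ p {q} → ord (⟦ p ⟧ K̄ ρ) ≡ fin q → ∀ k → ord (⟦ p ^P k ⟧ K̄ ρ) ≡ fin (k · q)
    ord-^P p e zero    = ord-1
    ord-^P p e (suc k) = trans (ord-* _ _) (cong₂ _+∞_ e (ord-^P p e k))

    ord-prodP : {A : Set} (h : A → Poly n) (e : A → ℚ) (as : List A) →
      All (λ a → ord (⟦ h a ⟧ K̄ ρ) ≡ fin (e a)) as →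
      ord (⟦ prodP (List.map h as) ⟧ K̄ ρ) ≡ fin (listSum e as)
    ord-prodP h e []       []       = ord-1
    ord-prodP h e (a ∷ as) (p ∷ ps) = trans (ord-* _ _) (cong₂ _+∞_ p (ord-prodP h e as ps))

-- Distances between roots and the valuation of `J`

toℚ : ℚ∞ → ℚ
toℚ (fin q) = q
toℚ ∞       = 0ℚ

Symmetric : ∀ {d} → Wt d → Set
Symmetric U = ∀ i j → U i j ≡ U j i

module Roots {c ℓ} {F : DVF c ℓ} {d} (f : SepPoly F d) where
  open DVF F
  open SepPoly f
  open Valuation F
  open Evaluation K̄
  private module K̄ = CommutativeRing K̄
  open RingProperties K̄.ring using (-‿anti-homo-+; -‿involutive)

  -- On the diagonal ∞ becomes the default 0; the ultrametric inequality can fail there, so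
  -- `dist-ultra` asks for distinct indices.
  dist : Fin d → Fin d → ℚ
  dist i j = toℚ (ordRoots f i j)

  ordRoots-dist : ∀ {i j} → i ≢ j → ordRoots f i j ≡ fin (dist i j)
  ordRoots-dist {i} {j} i≢j with ordRoots f i j in eq
  ... | fin q = refl
  ... | ∞     = contradiction (xᵢ≈xⱼ (proj₁ (ord-∞ _) eq)) (distinct i j i≢j)
    where
    xᵢ≈xⱼ : sub K̄ (x i) (x j) K̄.≈ K̄.0# → x i K̄.≈ x j
    xᵢ≈xⱼ e = begin
      x i                          ≈⟨ K̄.+-identityʳ _ ⟨
      x i K̄.+ K̄.0#                 ≈⟨ K̄.+-congˡ (K̄.-‿inverseˡ (x j)) ⟨
      x i K̄.+ (K̄.- x j K̄.+ x j)    ≈⟨ K̄.+-assoc _ _ _ ⟨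
      sub K̄ (x i) (x j) K̄.+ x j    ≈⟨ K̄.+-congʳ e ⟩
      K̄.0# K̄.+ x j                 ≈⟨ K̄.+-identityˡ _ ⟩
      x j                          ∎
      where open SetoidReasoning K̄.setoid

  dist-sym : ∀ i j → dist i j ≡ dist j i
  dist-sym i j = cong toℚ (trans (ord-cong (K̄.sym (K̄.trans (-‿anti-homo-+ _ _) (K̄.+-congʳ (-‿involutive _)))))
    (ord-‿ (sub K̄ (x j) (x i))))

  dist-ultra : ∀ {i j k} → i ≢ j → j ≢ k → i ≢ k → dist j k ℚ.⊓ dist i k ℚ.≤ dist i j
  dist-ultra {i} {j} {k} i≢j j≢k i≢k = ℚ.≤-trans (ℚ.≤-reflexive (ℚ.⊓-comm (dist j k) (dist i k)))
    (from-fin (subst₂ _≤∞_ (cong₂ min∞ (ordRoots-dist i≢k)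
      (trans (ord-‿ _) (ordRoots-dist j≢k))) (trans (ord-cong split) (ordRoots-dist i≢j))
      (ord-+ (sub K̄ (x i) (x k)) (K̄.- sub K̄ (x j) (x k)))))
    where
    from-fin : ∀ {p q} → fin p ≤∞ fin q → p ℚ.≤ q
    from-fin (fin≤fin p≤q) = p≤q
    split : sub K̄ (x i) (x k) K̄.+ K̄.- sub K̄ (x j) (x k) K̄.≈ sub K̄ (x i) (x j)
    split = begin
      (x i K̄.+ K̄.- x k) K̄.+ K̄.- (x j K̄.+ K̄.- x k) ≈⟨ K̄.+-congˡ (K̄.trans (-‿anti-homo-+ _ _) (K̄.+-congʳ (-‿involutive _))) ⟩
      (x i K̄.+ K̄.- x k) K̄.+ (x k K̄.+ K̄.- x j)      ≈⟨ K̄.+-assoc _ _ _ ⟩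
      x i K̄.+ (K̄.- x k K̄.+ (x k K̄.+ K̄.- x j))      ≈⟨ K̄.+-congˡ (K̄.+-assoc _ _ _) ⟨
      x i K̄.+ ((K̄.- x k K̄.+ x k) K̄.+ K̄.- x j)      ≈⟨ K̄.+-congˡ (K̄.+-congʳ (K̄.-‿inverseˡ _)) ⟩
      x i K̄.+ (K̄.0# K̄.+ K̄.- x j)                   ≈⟨ K̄.+-congˡ (K̄.+-identityˡ _) ⟩
      x i K̄.+ K̄.- x j                               ∎
      where open SetoidReasoning K̄.setoid

  ordₓ : Poly d → ℚ∞
  ordₓ p = ord (⟦ p ⟧ K̄ x)

  ordₓ-≐ : ∀ {p q} → p ≐ q → ordₓ p ≡ ordₓ q
  ordₓ-≐ {p} {q} p≐q = ord-cong (eval-≐ {p = p} {q} p≐q x)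

  -- By `roots` the coefficients are the signed elementary symmetric functions of the roots, so the
  -- value of `g` in `K` is also a polynomial value at the roots.
  ordAt-symmetric : ∀ g → ordAt f g ≡ ordₓ (g ∘P A d)
  ordAt-symmetric g = trans (ord-cong (K̄.trans (eval-hom {R = K} {K̄} ι-hom g a) (eval-cong g roots)))
    (cong ord (sym (eval-∘P g (A d) x)))

  -- The factor 2 in the exponents of denom turns a sum over i < j into one over ordered pairs.
  ordₓ-denom : ∀ {U} → Symmetric U → ordₓ (denom U) ≡ fin (pairing U dist)
  ordₓ-denom {U} U-sym = trans
    (ord-prodP x _ (λ ij → U (proj₁ ij) (proj₂ ij) · dist (proj₁ ij) (proj₂ ij)
                         + U (proj₁ ij) (proj₂ ij) · dist (proj₁ ij) (proj₂ ij)) (pairs d)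
      (All.map factor (pairs-< d)))
    (cong fin (listSum-pairs-double (λ i j → U i j · dist i j) λ i j → cong₂ _·_ (U-sym i j) (dist-sym i j)))
    where
    factor : ∀ {ij} → proj₁ ij Fin.< proj₂ ij →
      ordₓ ((var (proj₁ ij) ⊖ var (proj₂ ij)) ^P (2 ℕ.* U (proj₁ ij) (proj₂ ij))) ≡
      fin (U (proj₁ ij) (proj₂ ij) · dist (proj₁ ij) (proj₂ ij) + U (proj₁ ij) (proj₂ ij) · dist (proj₁ ij) (proj₂ ij))
    factor {i , j} i<j = trans
      (ord-^P x (var i ⊖ var j) (ordRoots-dist (Fin.<⇒≢ i<j)) (2 ℕ.* U i j))
      (cong fin (trans (×-homo-+ (dist i j) (U i j) (U i j ℕ.+ 0))
        (cong (λ m → U i j · dist i j + m · dist i j) (ℕ.+-identityʳ (U i j)))))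

  -- Disc d is definitionally the denominator of the graph with all weights 1.
  ordₓ-Disc : ordₓ (Disc d) ≡ fin (∑≠ dist)
  ordₓ-Disc = trans (ordₓ-denom {λ _ _ → 1} λ _ _ → refl)
    (cong fin (∑≠-cong λ i j _ → ℚ.+-identityʳ (dist i j)))

  -- The fraction J L is unreduced; its valuation is the difference of those of numerator and
  -- denominator, so δ - B stands for a valuation of - B.
  J-bounded : ∀ L {B} → All (λ U → Symmetric U × pairing U dist ℚ.< B) L →
    ∃[ δ ] (ordₓ (proj₂ (J L)) ≡ fin δ × δ - B <∞ ordₓ (proj₁ (J L)))
  J-bounded [] [] = 0ℚ , ord-1 , subst (_ <∞_) (sym (proj₂ (ord-∞ _) K̄.refl)) fin<∞
  J-bounded (U ∷ L) {B} ((U-sym , s<B) ∷ hs) with J-bounded L hs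
  ... | δ , D-ord , N-ord = s + δ
    , ord-*-fin (⟦ denom U ⟧ K̄ x) D (ordₓ-denom U-sym) D-ord
    , ord-+-> (subst (s + δ - B <∞_) (sym (ord-1* D D-ord)) (fin<fin (s+δ-B<δ s<B)))
        (subst (_<∞ _) (-‿+-comm δ s B) (ord-*-> N (⟦ denom U ⟧ K̄ x) N-ord (ordₓ-denom U-sym)))
    where
    s = pairing U dist
    N = ⟦ proj₁ (J L) ⟧ K̄ x
    D = ⟦ proj₂ (J L) ⟧ K̄ x

  -- Every summand other than the copy of `W` has valuation above `- B`, so the sum has valuation
  -- exactly `- B`. The induction follows the position of that copy: there the head dominates the
  -- rest, before it the tail dominates the head.
  J-attained : ∀ {W B} L → pairing W dist ≡ B →
    All (λ U → Symmetric U × (SameWt U W ⊎ pairing U dist ℚ.< B)) L →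
    Any (λ U → SameWt U W) L → AllPairs (λ U V → ¬ SameWt U V) L →
    ∃[ δ ] (ordₓ (proj₂ (J L)) ≡ fin δ × ordₓ (proj₁ (J L)) ≡ fin (δ - B))
  J-attained {W} {B} (U ∷ L) W-B ((U-sym , _) ∷ hs) (here U≈W) (U≉ ∷ _)
    -- Distinctness leaves no second copy of `W` in the tail, so all pairings there are strictly
    -- below `B`.
    with J-bounded L {B} (All.zipWith others (U≉ , hs))
    where
    others : ∀ {V} → ¬ SameWt U V × (Symmetric V × (SameWt V W ⊎ pairing V dist ℚ.< B)) →
      Symmetric V × pairing V dist ℚ.< B
    others (U≉V , V-sym , inj₁ V≈W) = contradiction (λ i j → trans (U≈W i j) (sym (V≈W i j))) U≉V
    others (U≉V , V-sym , inj₂ lt)  = V-sym , lt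
  ... | δ , D-ord , N-ord = B + δ
    , ord-*-fin (⟦ denom U ⟧ K̄ x) D ord-denom D-ord
    , trans (ord-+-dominant (ord-1* D D-ord)
        (subst (_<∞ _) (cancel δ) (ord-*-> N (⟦ denom U ⟧ K̄ x) N-ord ord-denom)))
      (cong fin (solve 2 (λ δ b → δ := b :+ δ :- b) refl δ B))
    where
    N = ⟦ proj₁ (J L) ⟧ K̄ x
    D = ⟦ proj₂ (J L) ⟧ K̄ x
    cancel : ∀ δ → δ - B + B ≡ δ
    cancel δ = solve 2 (λ δ b → δ :- b :+ b := δ) refl δ B
    ord-denom : ordₓ (denom U) ≡ fin B
    ord-denom = trans (ordₓ-denom U-sym)
      (cong fin (trans (∑≠-cong λ i j _ → cong (_· dist i j) (U≈W i j)) W-B))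
  J-attained {W} {B} (U ∷ L) W-B ((U-sym , U-B) ∷ hs) (there L≈W) (U≉ ∷ L-distinct)
    with J-attained L W-B hs L≈W L-distinct
  ... | δ , D-ord , N-ord = s + δ
    , ord-*-fin (⟦ denom U ⟧ K̄ x) D (ordₓ-denom U-sym) D-ord
    -- The dominant term is now the second one, the numerator of the tail times `denom U`; hence the
    -- swap.
    , trans (ord-cong (K̄.+-comm _ _))
        (ord-+-dominant
          (trans (ord-*-fin N (⟦ denom U ⟧ K̄ x) N-ord (ordₓ-denom U-sym)) (cong fin (-‿+-comm δ s B)))
          (subst (s + δ - B <∞_) (sym (ord-1* D D-ord)) (fin<fin (s+δ-B<δ (s<B U-B)))))
    where
    s = pairing U dist
    N = ⟦ proj₁ (J L) ⟧ K̄ x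
    D = ⟦ proj₂ (J L) ⟧ K̄ x
    s<B : SameWt U W ⊎ s ℚ.< B → s ℚ.< B
    s<B (inj₂ lt)  = lt
    s<B (inj₁ U≈W) = contradiction L≈W (All.All¬⇒¬Any (All.map (λ U≉V V≈W →
            U≉V λ i j → trans (U≈W i j) (sym (V≈W i j))) U≉))

-- Graphs of thresholds in 𝐆_d

count≤length : ∀ L q → count L q ℕ.≤ List.length L
count≤length [] q = ℕ.z≤n
count≤length (t ∷ L) q with t ≤? q
... | yes _ = ℕ.s≤s (count≤length L q)
... | no _  = ℕ.m≤n⇒m≤1+n (count≤length L q)

count-∷-≤ : ∀ {t q} L → t ℚ.≤ q → count (t ∷ L) q ≡ suc (count L q)
count-∷-≤ {t} {q} L t≤q with t ≤? q
... | yes _  = refl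
... | no t≰q = contradiction t≤q t≰q

count-below : ∀ {q} L → All (q ℚ.<_) L → count L q ≡ 0
count-below []      []          = refl
count-below {q} (t ∷ L) (q<t ∷ q<L) with t ≤? q
... | yes t≤q = contradiction q<t (≤⇒≯ t≤q)
... | no _    = count-below L q<L

-- The witness is the `k`-th threshold: in a strictly increasing list its count is its position,
-- starting from 1.
count-surjective : ∀ {L} → AllPairs ℚ._<_ L → ∀ k → 1 ℕ.≤ k → k ℕ.≤ List.length L →
  ∃[ t ] (t ∈ L × count L t ≡ k)
count-surjective {[]} _ (suc k) _ ()
count-surjective {t ∷ L} (t<L ∷ _) 1 _ _ =
  t , here refl , trans (count-∷-≤ L ℚ.≤-refl) (cong suc (count-below L t<L))
count-surjective {t ∷ L} (t<L ∷ L-sorted) (suc (suc k)) _ (ℕ.s≤s k<n)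
  with count-surjective L-sorted (suc k) (ℕ.s≤s ℕ.z≤n) k<n
... | u , u∈L , eq = u , there u∈L , trans (count-∷-≤ L (ℚ.<⇒≤ (All.lookup t<L u∈L))) (cong suc eq)

-- A threshold already present is not inserted again: a repetition would make `count` skip a weight,
-- which `InGd` forbids.
insert : ∀ t {L} → AllPairs ℚ._<_ L →
  ∃[ M ] (AllPairs ℚ._<_ M × t ∈ M × (∀ {u} → u ∈ L → u ∈ M) × (∀ {u} → u ∈ M → u ≡ t ⊎ u ∈ L))
insert t [] = t ∷ [] , [] ∷ [] , here refl , (λ ()) , λ { (here e) → inj₁ e }
insert t {s ∷ L} (s<L ∷ L-sorted) with ℚ.<-cmp t s
... | tri< t<s _ _ = t ∷ s ∷ L , (t<s ∷ All.map (ℚ.<-trans t<s) s<L) ∷ s<L ∷ L-sorted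
    , here refl , there , λ { (here e) → inj₁ e ; (there u∈) → inj₂ u∈ }
... | tri≈ _ t≡s _ = s ∷ L , s<L ∷ L-sorted , here t≡s , (λ u∈ → u∈) , inj₂
... | tri> _ _ s<t with insert t L-sorted
...   | M , M-sorted , t∈M , L⊆M , M⊆ = s ∷ M
    , All.tabulate (λ u∈M → s< (M⊆ u∈M)) ∷ M-sorted
    , there t∈M
    , (λ { (here e) → here e ; (there u∈L) → there (L⊆M u∈L) })
    , λ { (here e) → inj₂ (here e) ; (there u∈M) → weaken (M⊆ u∈M) }
  where
  s< : ∀ {u} → u ≡ t ⊎ u ∈ L → s ℚ.< u
  s< (inj₁ refl) = s<t
  s< (inj₂ u∈L)  = All.lookup s<L u∈L
  weaken : ∀ {u} → u ≡ t ⊎ u ∈ L → u ≡ t ⊎ u ∈ s ∷ L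
  weaken (inj₁ e)   = inj₁ e
  weaken (inj₂ u∈L) = inj₂ (there u∈L)

strictSort : ∀ xs → ∃[ M ] (AllPairs ℚ._<_ M × (∀ {u} → u ∈ xs → u ∈ M) × (∀ {u} → u ∈ M → u ∈ xs))
strictSort [] = [] , [] , (λ u∈ → u∈) , (λ u∈ → u∈)
strictSort (x ∷ xs) with strictSort xs
... | L , L-sorted , xs⊆L , L⊆xs with insert x L-sorted
...   | M , M-sorted , x∈M , L⊆M , M⊆ = M , M-sorted
    , (λ { (here refl) → x∈M ; (there u∈) → L⊆M (xs⊆L u∈) })
    , λ u∈M → back (M⊆ u∈M)
  where
  back : ∀ {u} → u ≡ x ⊎ u ∈ L → u ∈ x ∷ xs
  back (inj₁ e)   = here e
  back (inj₂ u∈L) = there (L⊆xs u∈L)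

module _ {d : ℕ} where

  -- That every value is in `L` lets each `v i j` serve as a threshold; that every element of `L` is
  -- a value makes all weights of `levels L v` occur.
  sortedValues : (v : Fin d → Fin d → ℚ) → ∃[ L ] (AllPairs ℚ._<_ L
    × (∀ {i j} → i ≢ j → v i j ∈ L)
    × (∀ {t} → t ∈ L → ∃[ i ] ∃[ j ] (i ≢ j × v i j ≡ t)))
  sortedValues v with strictSort (List.map (λ ij → v (proj₁ ij) (proj₂ ij)) offDiagonal)
    where
    offDiagonal : List (Fin d × Fin d)
    offDiagonal = List.filter (λ ij → ¬? (proj₁ ij ≟ proj₂ ij)) (List.cartesianProduct (List.allFin d) (List.allFin d))
  ... | L , L-sorted , xs⊆L , L⊆xs = L , L-sorted
    , (λ {i} {j} i≢j → xs⊆L (∈-map⁺ _ (∈-filter⁺ (λ ij → ¬? (proj₁ ij ≟ proj₂ ij))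
        (∈-cartesianProduct⁺ (∈-allFin i) (∈-allFin j)) i≢j)))
    , λ t∈L → attained (List.cartesianProduct (List.allFin d) (List.allFin d)) (∈-map⁻ _ (L⊆xs t∈L))
    where
    attained : ∀ {t} xs →
      ∃[ ij ] (ij ∈ List.filter (λ ij → ¬? (proj₁ ij ≟ proj₂ ij)) xs × t ≡ v (proj₁ ij) (proj₂ ij)) →
      ∃[ i ] ∃[ j ] (i ≢ j × v i j ≡ t)
    attained xs ((i , j) , ij∈ , e) = i , j , proj₂ (∈-filter⁻ (λ ij → ¬? (proj₁ ij ≟ proj₂ ij)) {xs = xs} ij∈) , sym e

  levels-sym : ∀ L (v : Fin d → Fin d → ℚ) → (∀ i j → v i j ≡ v j i) → Symmetric (levels L v)
  levels-sym L v v-sym i j with i ≟ j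
  ... | yes refl = sym (levels-diag L v i)
  ... | no i≢j   = trans (cong (count L) (v-sym i j)) (sym (levels-off L v (i≢j ∘ sym)))

  orbit-symmetric : ∀ {W U : Wt d} → Symmetric W → ∃[ σ ] SameWt U (relabel σ W) → Symmetric U
  orbit-symmetric W-sym (σ , U≈) i j = trans (U≈ i j) (trans (W-sym _ _) (sym (U≈ j i)))

  -- As `count L` is monotone, it carries the ultrametric inequality over to the weights.
  levels-InGd : ∀ L (v : Fin d → Fin d → ℚ) → (∀ i j → v i j ≡ v j i) →
    (∀ {i j k} → i ≢ j → j ≢ k → i ≢ k → v j k ℚ.⊓ v i k ℚ.≤ v i j) →
    1 ℕ.≤ List.length L →
    (∀ k → 1 ℕ.≤ k → k ℕ.≤ List.length L → ∃[ i ] ∃[ j ] (i ≢ j × count L (v i j) ≡ k)) →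
    InGd (levels L v)
  levels-InGd L v v-sym v-ultra L≥1 attained =
      levels-diag L v
    , levels-sym L v v-sym
    , (List.length L , L≥1 , bounded , surjective)
    , λ i j k i≢j j≢k i≢k → subst₂ ℕ._≤_
        (sym (cong₂ ℕ._⊓_ (levels-off L v j≢k) (levels-off L v i≢k))) (sym (levels-off L v i≢j))
        (ultra (v-ultra i≢j j≢k i≢k))
    where
    bounded : ∀ i j → levels L v i j ℕ.≤ List.length L
    bounded i j with i ≟ j
    ... | yes _ = ℕ.z≤n
    ... | no _  = count≤length L (v i j)
    surjective : ∀ k → 1 ℕ.≤ k → k ℕ.≤ List.length L → ∃[ i ] ∃[ j ] (levels L v i j ≡ k)
    surjective k 1≤k k≤n with attained k 1≤k k≤n
    ... | i , j , i≢j , e = i , j , trans (levels-off L v i≢j) e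
    ultra : ∀ {p q r} → p ℚ.⊓ q ℚ.≤ r → count L p ℕ.⊓ count L q ℕ.≤ count L r
    ultra {p} {q} {r} le with ℚ.≤-total p q
    ... | inj₁ p≤q = ℕ.≤-trans (ℕ.m⊓n≤m _ _) (count-mono L λ _ t≤p →
                       ℚ.≤-trans t≤p (subst (ℚ._≤ r) (ℚ.p≤q⇒p⊓q≡p p≤q) le))
    ... | inj₂ q≤p = ℕ.≤-trans (ℕ.m⊓n≤n (count L p) _) (count-mono L λ _ t≤q →
                       ℚ.≤-trans t≤q (subst (ℚ._≤ r) (ℚ.p≥q⇒p⊓q≡q q≤p) le))

-- Valuations of the discriminant and of `g` at the coefficients

module _ {c ℓ} {F : DVF c ℓ} {d} (f : SepPoly F d) where
  open DVF F
  open Roots f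

  ordAt-Δ : ∀ {Δ} → IsDelta Δ → ordAt f Δ ≡ fin (∑≠ dist)
  ordAt-Δ {Δ} isΔ = trans (ordAt-symmetric Δ) (trans (ordₓ-≐ {Δ ∘P A d} {Disc d} isΔ) ordₓ-Disc)

  module _ {W : Wt d} (D : GData W) where
    open GData D

    -- This is the valuation of the cross-multiplied identity `g-spec`, kept additive because the
    -- numerator of `J` may have valuation ∞.
    ordAt-g : ordₓ (proj₁ (J orbit)) +∞ fin (k · ∑≠ dist) ≡ ordAt f g +∞ ordₓ (proj₂ (J orbit))
    ordAt-g = begin
      ordₓ (proj₁ (J orbit)) +∞ fin (k · ∑≠ dist)
        ≡⟨ cong (ordₓ (proj₁ (J orbit)) +∞_) (Valuation.ord-^P F (SepPoly.x f) (Disc d) ordₓ-Disc k) ⟨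
      ordₓ (proj₁ (J orbit)) +∞ ordₓ (Disc d ^P k)
        ≡⟨ ord-* _ _ ⟨
      ordₓ (proj₁ (J orbit) ⊗ Disc d ^P k)
        ≡⟨ ordₓ-≐ {proj₁ (J orbit) ⊗ Disc d ^P k} {(g ∘P A d) ⊗ proj₂ (J orbit)} g-spec ⟩
      ordₓ ((g ∘P A d) ⊗ proj₂ (J orbit))
        ≡⟨ ord-* _ _ ⟩
      ordₓ (g ∘P A d) +∞ ordₓ (proj₂ (J orbit))
        ≡⟨ cong (_+∞ ordₓ (proj₂ (J orbit))) (ordAt-symmetric g) ⟨
      ordAt f g +∞ ordₓ (proj₂ (J orbit)) ∎
      where open ≡-Reasoning

  -- By `self-pairing-max` any other graph in the orbit pairs strictly lower, so `J-attained` gives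
  -- `J` minus the pairing as valuation; the power of the discriminant adds `k · ∑≠ dist`.
  ordAt-g-levels : ∀ L (D : GData (levels L dist)) →
    ordAt f (GData.g D) ≡ fin (GData.k D · ∑≠ dist - pairing (levels L dist) dist)
  ordAt-g-levels L D with J-attained orbit refl (All.map classify (proj₁ isOrbit))
      -- The identity relabelling locates the copy of `W` in its own orbit.
      (proj₁ (proj₂ isOrbit) Permutation.id) (proj₂ (proj₂ isOrbit))
    where
    open GData D
    W = levels L dist
    classify : ∀ {U} → ∃[ σ ] SameWt U (relabel σ W) →
      Symmetric U × (SameWt U W ⊎ pairing U dist ℚ.< pairing W dist)
    classify {U} (σ , U≈) = orbit-symmetric (levels-sym L dist dist-sym) (σ , U≈) , dichotomy
      where
      same-pairing : pairing U dist ≡ pairing (relabel σ W) dist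
      same-pairing = ∑≠-cong λ i j _ → cong (_· dist i j) (U≈ i j)
      dichotomy : SameWt U W ⊎ pairing U dist ℚ.< pairing W dist
      dichotomy with pairing W dist ≤? pairing (relabel σ W) dist
      ... | yes le = inj₁ λ i j → trans (U≈ i j) (sym (self-pairing-max L dist σ le i j))
      ... | no ≰   = inj₂ (subst (ℚ._< _) (sym same-pairing) (ℚ.≰⇒> ≰))
  ... | δ , D-ord , N-ord = trans
    (+∞-fin-injective (ordAt f g) (trans (cong (ordAt f g +∞_) (sym D-ord))
      (trans (sym (ordAt-g D)) (cong (_+∞ fin (k · ∑≠ dist)) N-ord))))
    (cong fin (solve 3 (λ δ b e → δ :- b :+ e :- δ := e :- b) refl δ (pairing (levels L dist) dist) (k · ∑≠ dist)))
    where open GData D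

-- Comparison of two polynomials

module Comparison {c ℓ c′ ℓ′} {F : DVF c ℓ} {F′ : DVF c′ ℓ′} {d} (f : SepPoly F d) (f′ : SepPoly F′ d)
  (∑≡ : ∑≠ (Roots.dist f) ≡ ∑≠ (Roots.dist f′))
  (gd : (W : Wt d) → InGd W → GData W)
  (g≡ : ∀ W w → ordAt f (GData.g (gd W w)) ≡ ordAt f′ (GData.g (gd W w))) where

  private
    v  = Roots.dist f
    v′ = Roots.dist f′

  -- Let `B` be the left-hand pairing. If the whole orbit paired with `v′` below `B`, then by
  -- `J-bounded` the sum `J` at the roots of `f′` would have valuation above `- B`; but `g≡` and
  -- `∑≡` make it exactly `- B`.
  levels-pairing-≤ : ∀ L → InGd (levels L v) →
    ∃[ σ ] (pairing (levels L v) v ℚ.≤ pairing (relabel σ (levels L v)) v′)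
  levels-pairing-≤ L w with Any.any? (λ U → pairing (levels L v) v ≤? pairing U v′) (GData.orbit (gd _ w))
  ... | yes some with All.lookupAny (proj₁ (GData.isOrbit (gd _ w))) some
  ...   | (σ , U≈) , le = σ , subst (_ ℚ.≤_) (∑≠-cong λ i j _ → cong (_· v′ i j) (U≈ i j)) le
  levels-pairing-≤ L w | no none
    with Roots.J-bounded f′ orbit (All.zipWith
           (λ (in-orbit , ≰) → orbit-symmetric (levels-sym L v (Roots.dist-sym f)) in-orbit , ℚ.≰⇒> ≰)
           (proj₁ isOrbit , All.¬Any⇒All¬ _ none))
    where open GData (gd _ w)
  ... | δ , D-ord , N-ord = contradiction N-ord λ lt → <∞-irrefl (subst (_ <∞_) N≡ lt)
    where
    open GData (gd _ w)
    B = pairing (levels L v) v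
    N≡ : Roots.ordₓ f′ (proj₁ (J orbit)) ≡ fin (δ - B)
    N≡ = trans (+∞-fin-injective _ (trans (ordAt-g f′ (gd _ w))
           (cong₂ _+∞_ (trans (sym (g≡ _ w)) (trans (ordAt-g-levels f L (gd _ w))
             (cong (λ e → fin (k · e - B)) ∑≡))) D-ord)))
         (cong fin (solve 3 (λ e b δ → e :- b :+ δ :- e := δ :- b) refl (k · ∑≠ v′) B δ))

  -- The pair `i ≢ j` supplies a value, so that `L` is nonempty and the largest weight is at least
  -- 1.
  values-alignment : ∀ {i j : Fin d} → i ≢ j → ∀ L → AllPairs ℚ._<_ L →
    (∀ {i j} → i ≢ j → v i j ∈ L) → (∀ {t} → t ∈ L → ∃[ i ] ∃[ j ] (i ≢ j × v i j ≡ t)) →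
    ∃[ σ ] (pairing (levels L v) v ℚ.≤ pairing (relabel σ (levels L v)) v′)
  values-alignment i≢j L L-sorted v∈L L∈v = levels-pairing-≤ L (levels-InGd L v (Roots.dist-sym f) (Roots.dist-ultra f)
    (nonempty (v∈L i≢j)) attained)
    where
    nonempty : ∀ {t} {M : List ℚ} → t ∈ M → 1 ℕ.≤ List.length M
    nonempty (here _)  = ℕ.s≤s ℕ.z≤n
    nonempty (there _) = ℕ.s≤s ℕ.z≤n
    attained : ∀ k → 1 ℕ.≤ k → k ℕ.≤ List.length L → ∃[ i ] ∃[ j ] (i ≢ j × count L (v i j) ≡ k)
    attained k 1≤k k≤n with count-surjective L-sorted k 1≤k k≤n
    ... | t , t∈L , e with L∈v t∈L
    ...   | i , j , i≢j , refl = i , j , i≢j , e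

  excess-singleton : ∀ t (u : Fin d → Fin d → ℚ) →
    ∑≠ (λ i j → excess (t ∷ []) (u i j) (u i j)) ≡ ∑≠ (λ i j → step t (u i j) (u i j))
  excess-singleton t u = ∑≠-cong λ i j _ → ℚ.+-identityʳ (step t (u i j) (u i j))

  step-bound : ∀ t → ∑≠ (λ i j → step t (v i j) (v i j)) ℚ.≤ ∑≠ (λ i j → step t (v′ i j) (v′ i j))
  step-bound t with Fin.any? (λ i → Fin.any? (λ j → ¬? (i ≟ j) ×-dec (t ≤? v i j)))
  -- When no value of `v` reaches `t`, the threshold graph has no edges and is outside `𝐆_d`, but
  -- the left side is then a sum of zeros.
  ... | no none = ∑≠-mono λ i j i≢j → ℚ.≤-trans
          (ℚ.≤-reflexive (step-above (λ t≤v → none (i , j , i≢j , t≤v)))) (step-nonNeg (v′ i j))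
    where
    step-above : ∀ {q} → ¬ (t ℚ.≤ q) → step t q q ≡ 0ℚ
    step-above {q} t≰q with t ≤? q
    ... | yes t≤q = contradiction t≤q t≰q
    ... | no _    = refl
    step-nonNeg : ∀ q → 0ℚ ℚ.≤ step t q q
    step-nonNeg q with t ≤? q
    ... | yes t≤q = 0≤-⁻ t≤q
    ... | no _    = ℚ.≤-refl
  ... | yes (i , j , i≢j , t≤v) with levels-pairing-≤ (t ∷ []) (levels-InGd (t ∷ []) v (Roots.dist-sym f)
          (Roots.dist-ultra f) (ℕ.s≤s ℕ.z≤n) attained)
    where
    attained : ∀ k → 1 ℕ.≤ k → k ℕ.≤ 1 → ∃[ i ] ∃[ j ] (i ≢ j × count (t ∷ []) (v i j) ≡ k)
    attained 1 _ _ = i , j , i≢j , count-∷-≤ [] t≤v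
    attained (suc (suc _)) _ (ℕ.s≤s ())
  ...   | σ , le = subst₂ ℚ._≤_ (excess-singleton t v) (excess-singleton t v′)
                     (Rearrangement.excess-bound (t ∷ []) v v′ σ le)

  -- One threshold is treated at a time because `L` will come from the other polynomial:
  -- `levels L v` may then skip weights and fall outside `𝐆_d`.
  excess-bound : ∀ L → ∑≠ (λ i j → excess L (v i j) (v i j)) ℚ.≤ ∑≠ (λ i j → excess L (v′ i j) (v′ i j))
  excess-bound []      = ∑≠-mono {f = λ i j → excess [] (v i j) (v i j)} {λ i j → excess [] (v′ i j) (v′ i j)}
    λ _ _ _ → ℚ.≤-refl {0ℚ}
  excess-bound (t ∷ L) = subst₂ ℚ._≤_
    (sym (∑≠-distrib-+ (λ i j → step t (v i j) (v i j)) (λ i j → excess L (v i j) (v i j))))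
    (sym (∑≠-distrib-+ (λ i j → step t (v′ i j) (v′ i j)) (λ i j → excess L (v′ i j) (v′ i j))))
    (ℚ.+-mono-≤ (step-bound t) (excess-bound L))

roots-matching : ∀ {c ℓ c′ ℓ′} {F : DVF c ℓ} {F′ : DVF c′ ℓ′} {d} {i₀ j₀ : Fin d} → i₀ ≢ j₀ →
  ∀ {Δ : Poly d} → IsDelta Δ → (gd : (W : Wt d) → InGd W → GData W) →
  (f : SepPoly F d) (f′ : SepPoly F′ d) → ordAt f Δ ≡ ordAt f′ Δ →
  (∀ W w → ordAt f (GData.g (gd W w)) ≡ ordAt f′ (GData.g (gd W w))) →
  ∃[ σ ] (∀ i j → i ≢ j → ordRoots f (σ ⟨$⟩ˡ i) (σ ⟨$⟩ˡ j) ≡ ordRoots f′ i j)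
roots-matching i₀≢j₀ {Δ} isΔ gd f f′ Δ≡ g≡ = σ , λ i j i≢j →
  trans (Roots.ordRoots-dist f (⟨$⟩ˡ-≢ σ i≢j)) (trans
    (cong fin (ℚ.≤-antisym (v∘σ≤v′ i j i≢j) (v′≤v∘σ i j i≢j)))
    (sym (Roots.ordRoots-dist f′ i≢j)))
  where
  open Roots f using () renaming (dist to v)
  open Roots f′ using () renaming (dist to v′)
  ∑≡ : ∑≠ v ≡ ∑≠ v′
  ∑≡ = fin-injective (trans (sym (ordAt-Δ f {Δ} isΔ)) (trans Δ≡ (ordAt-Δ f′ {Δ} isΔ)))
  open Comparison f f′ ∑≡ gd g≡ using (values-alignment)
  -- The roles are exchanged to obtain the reverse bound that `aligned` requires.
  open Comparison f′ f (sym ∑≡) gd (λ W w → sym (g≡ W w)) using (excess-bound)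
  values = sortedValues v
  L = proj₁ values
  v∈L = proj₁ (proj₂ (proj₂ values))
  alignment = values-alignment i₀≢j₀ L (proj₁ (proj₂ values)) v∈L (proj₂ (proj₂ (proj₂ values)))
  σ = proj₁ alignment
  v∘σ≤v′ : ∀ i j → i ≢ j → (v ∘₂ σ) i j ℚ.≤ v′ i j
  -- The threshold tested is the value of `v ∘₂ σ` at the pair itself.
  v∘σ≤v′ i j i≢j = Rearrangement.aligned L v v′ σ (proj₂ alignment) (excess-bound L) i≢j
    (v∈L (⟨$⟩ˡ-≢ σ i≢j)) ℚ.≤-refl
  v′≤v∘σ : ∀ i j → i ≢ j → v′ i j ℚ.≤ (v ∘₂ σ) i j
  v′≤v∘σ = ∑≠-tight v∘σ≤v′ (ℚ.≤-reflexive (trans (sym ∑≡) (∑≠-permute v σ)))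

theorem4p3 : ∀ {c ℓ c′ ℓ′ : Level} (d : ℕ) → 2 ≤ d →
    (Δ : Poly d) → IsDelta Δ →
    (gd : (W : Wt d) → InGd W → GData W) →
    (F : DVF c ℓ) (F′ : DVF c′ ℓ′) →
    (f : SepPoly F d) (f′ : SepPoly F′ d) →
    ordAt f Δ ≡ ordAt f′ Δ →
    (∀ (W : Wt d) (w : InGd W) → ordAt f (GData.g (gd W w)) ≡ ordAt f′ (GData.g (gd W w))) →
    Σ (Permutation′ d) (λ π → ∀ (i j : Fin d) → i < j →
    ordRoots f (π ⟨$⟩ʳ i) (π ⟨$⟩ʳ j) ≡ ordRoots f′ i j)
theorem4p3 (suc (suc d)) (ℕ.s≤s (ℕ.s≤s ℕ.z≤n)) Δ isΔ gd F F′ f f′ Δ≡ g≡ =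
  -- The matching permutes by the inverse, as `relabel` does; hence `flip`.
  flip (proj₁ matching) , λ i j i<j → proj₂ matching i j (Fin.<⇒≢ i<j)
  where
  0≢1 : Fin.zero {suc d} ≢ Fin.suc Fin.zero
  0≢1 ()
  matching = roots-matching 0≢1 {Δ} isΔ gd f f′ Δ≡ g≡
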